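{- Let $p\in\mathrm{AP}$ be an atomic proposition. 1. No TeamLTL-formula is equivalent to the HyperLTL sentence $\exists\pi.\,p_\pi$. 2. No HyperLTL sentence is equivalent to the TeamLTL-formula $\mathsf{F}p$.
   Context: Let $\mathrm{AP}$ be a countably infinite set of atomic propositions. A trace is an infinite sequence $t=t(0)t(1)t(2)\cdots\in(2^{\mathrm{AP}})^\omega$; $t[i,\infty)=t(i)t(i+1)\cdots$. A team is a (possibly infinite) set $T\subseteq(2^{\mathrm{AP}})^\omega$ of traces, and $T[i,\infty)=\{t[i,\infty)\mid t\in T\}$. TeamLTL. Formulae: $\varphi ::= p\mid\neg p\mid\varphi\land\varphi\mid\varphi\lor\varphi\mid\mathsf{X}\varphi\mid\varphi\mathsf{U}\varphi\mid\varphi\mathsf{R}\varphi$ with $p\in\mathrm{AP}$; $\top:=p\lor\neg p$ and $\mathsf{F}\varphi:=\top\mathsf{U}\varphi$. Team semantics: - $T\models p$ iff $p\in t(0)$ for all $t\in T$; $T\models\neg p$ iff $p\notin t(0)$ for all $t\in T$. - $T\models\psi\land\phi$ iff $T\models\psi$ and $T\models\phi$. - $T\models\psi\lor\phi$ iff there are $T_1,T_2$ with $T_1\cup T_2=T$, $T_1\models\psi$ and $T_2\models\phi$. - $T\models\mathsf{X}\varphi$ iff $T[1,\infty)\models\varphi$. - $T\models\psi\mathsf{U}\phi$ iff there is $k\ge0$ with $T[k,\infty)\models\phi$ and $T[k',\infty)\models\psi$ for all $k'<k$. - $T\models\psi\mathsf{R}\phi$ iff for all $k\ge0$: $T[k,\infty)\models\phi$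 or there is $k'<k$ with $T[k',\infty)\models\psi$. HyperLTL. Formulae: $\phi ::= \exists\pi.\phi\mid\forall\pi.\phi\mid\psi$ and $\psi ::= p_\pi\mid\neg\psi\mid\psi\lor\psi\mid\mathsf{X}\psi\mid\psi\mathsf{U}\psi$, with $p\in\mathrm{AP}$ and $\pi$ from a countable set $\mathcal{V}$ of trace variables; a sentence is a formula without free trace variables. Semantics is given w.r.t. a team $T$ and a trace assignment, i.e. a partial map $\Pi\colon\mathcal{V}\to(2^{\mathrm{AP}})^\omega$; $\Pi_\emptyset$ is the assignment with empty domain, $\Pi[\pi\to t]$ is the update, and $\Pi[i,\infty)$ maps each $\pi$ in the domain to $\Pi(\pi)[i,\infty)$. - $(T,\Pi)\models p_\pi$ iff $p\in\Pi(\pi)(0)$; $\neg$ and $\lor$ are interpreted classically. - $(T,\Pi)\models\mathsf{X}\psi$ iff $(T,\Pi[1,\infty))\models\psi$. - $(T,\Pi)\models\psi_1\mathsf{U}\psi_2$ iff there is $k\ge0$ with $(T,\Pi[k,\infty))\models\psi_2$ and $(T,\Pi[k',\infty))\models\psi_1$ for all $0\le k'<k$. - $(T,\Pi)\models\exists\pi.\psi$ (resp. $\forall\pi.\psi$) iff for some (resp. all) $t\in T$: $(T,\Pi[\pi\to t])\models\psi$. $T$ satisfies a sentence $\phi$, written $T\models\phi$, if $(T,\Pi_\emptyset)\models\phi$. A HyperLTL sentence and a TeamLTL-formula are equivalent if they are satisfied by exactly the same teams $T$. -}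

module Defs where

open import Data.Bool using (Bool; true; if_then_else_)
open import Data.Maybe using (Maybe; just; nothing)
import Data.Maybe as Maybe
open import Data.Maybe.Relation.Unary.Any using (Any)
open import Data.Nat using (ℕ; _+_; _<_)
import Data.Nat.Properties as ℕ
open import Data.Product using (∃-syntax; _×_; _,_)
open import Data.Sum using (_⊎_)
open import Function.Bundles using (_↣_; _⇔_)
open import Level using (Lift; 0ℓ)
import Level
open import Relation.Binary.Core using (Rel)
open import Relation.Binary.Definitions using (DecidableEquality; _Respects_)
open import Relation.Binary.PropositionalEquality using (_≡_; trans)
open import Relation.Nullary using (¬_; does)
open import Relation.Nullary.Decidable using (via-injection)
open import Relation.Unary using (Pred; _∪_; _≐_; Empty)

-- Traces: elements of (2^AP)^ω, where q ∈ t(k) is encoded as t k q ≡ true.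
-- Traces are compared pointwise, since Agda has no function extensionality.

Trace : Set → Set
Trace AP = ℕ → AP → Bool

module _ {AP : Set} where

  infix 4 _≈_

  _≈_ : Rel (Trace AP) 0ℓ
  t ≈ t′ = ∀ k q → t k q ≡ t′ k q

  infix 20 _[_,∞⟩

  _[_,∞⟩ : Trace AP → ℕ → Trace AP
  (t [ i ,∞⟩) k = t (i + k)

-- A team is a subset of the setoid of traces: membership may not tell apart
-- pointwise equal traces.

record Team (AP : Set) : Set₁ where
  field
    member : Pred (Trace AP) 0ℓ
    resp   : member Respects _≈_

open Team public

module _ {AP : Set} where

  infix 20 _⟦_,∞⟩

  _⟦_,∞⟩ : Team AP → ℕ → Team AP
  (T ⟦ i ,∞⟩) .member t′ = ∃[ t ] (member T t × t [ i ,∞⟩ ≈ t′)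
  (T ⟦ i ,∞⟩) .resp t′≈t″ (t , t∈T , t≈t′) =
    t , t∈T , λ k q → trans (t≈t′ k q) (t′≈t″ k q)

infixr 7 _∧ᵗ_
infixr 6 _∨ᵗ_
infixr 5 _Uᵗ_ _Rᵗ_

data TeamLTL (AP : Set) : Set where
  posᵗ : AP → TeamLTL AP
  negᵗ : AP → TeamLTL AP
  _∧ᵗ_ : TeamLTL AP → TeamLTL AP → TeamLTL AP
  _∨ᵗ_ : TeamLTL AP → TeamLTL AP → TeamLTL AP
  Xᵗ   : TeamLTL AP → TeamLTL AP
  _Uᵗ_ : TeamLTL AP → TeamLTL AP → TeamLTL AP
  _Rᵗ_ : TeamLTL AP → TeamLTL AP → TeamLTL AP

module _ {AP : Set} where

  -- ⊤ abbreviates q ∨ ¬ q; the choice of the proposition q is left open, so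
  -- it is a parameter of ⊤ and of F.

  ⊤ᵗ : AP → TeamLTL AP
  ⊤ᵗ q = posᵗ q ∨ᵗ negᵗ q

  Fᵗ : AP → TeamLTL AP → TeamLTL AP
  Fᵗ q φ = ⊤ᵗ q Uᵗ φ

  infix 4 _⊨ᵗ_

  -- The values lie in Set₁ because splitting quantifies over teams.

  _⊨ᵗ_ : Team AP → TeamLTL AP → Set₁
  T ⊨ᵗ posᵗ q   = Lift (Level.suc 0ℓ) (∀ t → member T t → t 0 q ≡ true)
  T ⊨ᵗ negᵗ q   = Lift (Level.suc 0ℓ) (∀ t → member T t → ¬ (t 0 q ≡ true))
  T ⊨ᵗ (ψ ∧ᵗ φ) = T ⊨ᵗ ψ × T ⊨ᵗ φ
  T ⊨ᵗ (ψ ∨ᵗ φ) = ∃[ T₁ ] ∃[ T₂ ]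
    ((member T₁ ∪ member T₂) ≐ member T × T₁ ⊨ᵗ ψ × T₂ ⊨ᵗ φ)
  T ⊨ᵗ Xᵗ φ     = T ⟦ 1 ,∞⟩ ⊨ᵗ φ
  T ⊨ᵗ (ψ Uᵗ φ) = ∃[ k ]
    (T ⟦ k ,∞⟩ ⊨ᵗ φ × (∀ k′ → k′ < k → T ⟦ k′ ,∞⟩ ⊨ᵗ ψ))
  T ⊨ᵗ (ψ Rᵗ φ) = ∀ k →
    T ⟦ k ,∞⟩ ⊨ᵗ φ ⊎ ∃[ k′ ] (k′ < k × T ⟦ k′ ,∞⟩ ⊨ᵗ ψ)

infix  9 _at_
infix  8 ¬ʰ_
infixr 6 _∨ʰ_
infixr 5 _Uʰ_

data Body (AP 𝒱 : Set) : Set where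
  _at_ : AP → 𝒱 → Body AP 𝒱
  ¬ʰ_  : Body AP 𝒱 → Body AP 𝒱
  _∨ʰ_ : Body AP 𝒱 → Body AP 𝒱 → Body AP 𝒱
  Xʰ   : Body AP 𝒱 → Body AP 𝒱
  _Uʰ_ : Body AP 𝒱 → Body AP 𝒱 → Body AP 𝒱

data HyperLTL (AP 𝒱 : Set) : Set where
  ∃ʰ   : 𝒱 → HyperLTL AP 𝒱 → HyperLTL AP 𝒱
  ∀ʰ   : 𝒱 → HyperLTL AP 𝒱 → HyperLTL AP 𝒱
  body : Body AP 𝒱 → HyperLTL AP 𝒱

module _ {AP 𝒱 : Set} where

  freeᵇ : Body AP 𝒱 → Pred 𝒱 0ℓ
  freeᵇ (q at π)   π′ = π′ ≡ π
  freeᵇ (¬ʰ ψ)     π′ = freeᵇ ψ π′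
  freeᵇ (ψ₁ ∨ʰ ψ₂) π′ = freeᵇ ψ₁ π′ ⊎ freeᵇ ψ₂ π′
  freeᵇ (Xʰ ψ)     π′ = freeᵇ ψ π′
  freeᵇ (ψ₁ Uʰ ψ₂) π′ = freeᵇ ψ₁ π′ ⊎ freeᵇ ψ₂ π′

  free : HyperLTL AP 𝒱 → Pred 𝒱 0ℓ
  free (∃ʰ π φ) π′ = ¬ (π′ ≡ π) × free φ π′
  free (∀ʰ π φ) π′ = ¬ (π′ ≡ π) × free φ π′
  free (body ψ) π′ = freeᵇ ψ π′

  IsSentence : HyperLTL AP 𝒱 → Set
  IsSentence φ = Empty (free φ)

-- Trace assignments are partial maps.

Assignment : Set → Set → Set
Assignment AP 𝒱 = 𝒱 → Maybe (Trace AP)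

module _ {AP 𝒱 : Set} where

  Π∅ : Assignment AP 𝒱
  Π∅ _ = nothing

  infix 20 _⟪_,∞⟩

  _⟪_,∞⟩ : Assignment AP 𝒱 → ℕ → Assignment AP 𝒱
  (Π ⟪ i ,∞⟩) π = Maybe.map (_[ i ,∞⟩) (Π π)

  infix 4 _⊨ᵇ_

  -- The team plays no role below the quantifier prefix and is omitted.
  -- An atom about a trace variable outside the domain of Π is false; this
  -- never arises when evaluating a sentence in Π∅.

  _⊨ᵇ_ : Assignment AP 𝒱 → Body AP 𝒱 → Set
  Π ⊨ᵇ q at π     = Any (λ t → t 0 q ≡ true) (Π π)
  Π ⊨ᵇ ¬ʰ ψ       = ¬ (Π ⊨ᵇ ψ)
  Π ⊨ᵇ (ψ₁ ∨ʰ ψ₂) = Π ⊨ᵇ ψ₁ ⊎ Π ⊨ᵇ ψ₂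
  Π ⊨ᵇ Xʰ ψ       = Π ⟪ 1 ,∞⟩ ⊨ᵇ ψ
  Π ⊨ᵇ (ψ₁ Uʰ ψ₂) = ∃[ k ]
    (Π ⟪ k ,∞⟩ ⊨ᵇ ψ₂ × (∀ k′ → k′ < k → Π ⟪ k′ ,∞⟩ ⊨ᵇ ψ₁))

-- Countability of the set of trace variables is an injection into ℕ, which
-- also supplies the decidable equality needed to update assignments.

module _ {AP 𝒱 : Set} (countable : 𝒱 ↣ ℕ) where

  _≟ᵛ_ : DecidableEquality 𝒱
  _≟ᵛ_ = via-injection countable ℕ._≟_

  update : Assignment AP 𝒱 → 𝒱 → Trace AP → Assignment AP 𝒱
  update Π π t π′ = if does (π′ ≟ᵛ π) then just t else Π π′

  Sat : Team AP → Assignment AP 𝒱 → HyperLTL AP 𝒱 → Set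
  Sat T Π (∃ʰ π φ) = ∃[ t ] (member T t × Sat T (update Π π t) φ)
  Sat T Π (∀ʰ π φ) = ∀ t → member T t → Sat T (update Π π t) φ
  Sat T Π (body ψ) = Π ⊨ᵇ ψ

  Equivalent : HyperLTL AP 𝒱 → TeamLTL AP → Set₁
  Equivalent φ χ = ∀ (T : Team AP) → Sat T Π∅ φ ⇔ T ⊨ᵗ χ

{-# OPTIONS --safe #-}
-- Part 1: the empty team satisfies every TeamLTL formula, but no sentence that
-- begins with an existential quantifier.
--
-- Part 2: let n be the number of quantifiers of φ and d the temporal depth of
-- its body.  Consider teams of n + 1 rows, written as a word of columns, where
-- column l < n + 1 lacks p in row l only and column n + 1 has p in every row.
-- Since LTL is aperiodic, there is a word Z over the columns 0, …, n such that
-- Z j Z v and Z v agree up to depth d for all j ≤ n and all v.  The rows of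
-- Z 0 0 0 … violate F p and those of Z (n + 1) Z 0 0 0 … satisfy it.  But any n
-- rows omit some row j, hence cannot tell the column n + 1 from the column j,
-- so they satisfy the same bodies of depth d in the two teams.
module Submission where

open import Defs
open import Data.Bool using (true; false; not; if_then_else_)
import Data.Bool as Bool
open import Data.Empty using (⊥)
open import Data.Fin using (Fin; toℕ)
import Data.Fin.Properties as Fin
open import Data.List using (List; []; _∷_; _++_; _∷ʳ_; length; concat; replicate)
import Data.List.Membership.DecPropositional as DecMembership
open import Data.List.Membership.Propositional using (_∈_; _∉_)
import Data.List.Membership.Setoid.Properties as Membership
open import Data.List.Relation.Unary.All using (All; []; _∷_)
import Data.List.Relation.Unary.All as All
import Data.List.Relation.Unary.All.Properties as All
open import Data.List.Relation.Unary.Any using (here; there; index)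
import Data.Maybe as Maybe
open import Data.Maybe.Relation.Binary.Pointwise using (Pointwise; just; nothing)
open import Data.Maybe.Relation.Unary.Any using (Any; just)
open import Data.Nat
open import Data.Nat.Properties
open import Data.Product using (∃-syntax; _×_; _,_; proj₁; proj₂)
open import Data.Sum using (_⊎_; inj₁; inj₂; [_,_]′)
import Data.Sum as Sum
open import Function using (const; id)
open import Function.Bundles using (_↔_; _↣_; Equivalence)
open import Level using (lift; 0ℓ)
open import Relation.Binary.Core using (Rel)
open import Relation.Binary.PropositionalEquality
  using (_≡_; _≢_; refl; sym; trans; cong; subst; setoid)
open import Relation.Nullary using (¬_; yes; no; does; contradiction)
open import Relation.Nullary.Decidable using (dec-true; dec-false)
open import Relation.Unary using (Empty)

-- Team satisfaction in the empty team, and validity of `⊤ᵗ`.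

module _ {AP : Set} where

  ∅ : Team AP
  ∅ .member _ = ⊥
  ∅ .resp _ ()

  -- Stated for every memberless team because the induction passes to suffix teams, which are empty
  -- without being `∅` by definition.
  empty-⊨ᵗ : ∀ (χ : TeamLTL AP) (T : Team AP) → Empty (member T) → T ⊨ᵗ χ
  empty-⊨ᵗ (posᵗ q) T e = lift λ t t∈T → contradiction t∈T (e t)
  empty-⊨ᵗ (negᵗ q) T e = lift λ t t∈T → contradiction t∈T (e t)
  empty-⊨ᵗ (ψ ∧ᵗ φ) T e = empty-⊨ᵗ ψ T e , empty-⊨ᵗ φ T e
  empty-⊨ᵗ (ψ ∨ᵗ φ) T e =
    T , T , ([ id , id ]′ , inj₁) , empty-⊨ᵗ ψ T e , empty-⊨ᵗ φ T e
  empty-⊨ᵗ (Xᵗ φ)   T e = empty-⊨ᵗ φ _ λ { _ (t , t∈T , _) → e t t∈T }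
  empty-⊨ᵗ (ψ Uᵗ φ) T e =
    0 , empty-⊨ᵗ φ _ (λ { _ (t , t∈T , _) → e t t∈T }) , λ _ ()
  empty-⊨ᵗ (ψ Rᵗ φ) T e k = inj₁ (empty-⊨ᵗ φ _ λ { _ (t , t∈T , _) → e t t∈T })

  -- Traces are Boolean-valued, so the team can be split constructively by the value of `q` at time
  -- 0.
  ⊨⊤ᵗ : ∀ q (T : Team AP) → T ⊨ᵗ ⊤ᵗ q
  ⊨⊤ᵗ q T =
    with-q , without-q , (join , split) , lift (λ _ → proj₂) , lift (λ _ → proj₂)
    where
    with-q : Team AP
    with-q .member t = member T t × t 0 q ≡ true
    with-q .resp e (t∈T , h) = resp T e t∈T , trans (sym (e 0 q)) h

    without-q : Team AP
    without-q .member t = member T t × ¬ (t 0 q ≡ true)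
    without-q .resp e (t∈T , h) = resp T e t∈T , λ h′ → h (trans (e 0 q) h′)

    join : ∀ {t} → member with-q t ⊎ member without-q t → member T t
    join = [ proj₁ , proj₁ ]′

    split : ∀ {t} → member T t → member with-q t ⊎ member without-q t
    split {t} t∈T with t 0 q Bool.≟ true
    ... | yes h = inj₁ (t∈T , h)
    ... | no  h = inj₂ (t∈T , h)

-- Infinite words and temporal equivalence

Word : Set → Set
Word A = ℕ → A

module _ {A : Set} where

  infixr 5 _◂_ _⧺_
  infix 8 _↓_
  infix 4 _∼[_]_

  _◂_ : A → Word A → Word A
  (a ◂ w) zero    = a
  (a ◂ w) (suc k) = w k

  _⧺_ : List A → Word A → Word A
  []      ⧺ w = w
  (a ∷ x) ⧺ w = a ◂ (x ⧺ w)

  _↓_ : Word A → ℕ → Word A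
  (w ↓ k) i = w (k + i)

  ↓-⧺ : ∀ x (w : Word A) k → (x ⧺ w) ↓ (length x + k) ≡ w ↓ k
  ↓-⧺ []      w k = refl
  ↓-⧺ (a ∷ x) w k = ↓-⧺ x w k

  ⧺-lookup : ∀ x (w : Word A) k → (x ⧺ w) (length x + k) ≡ w k
  ⧺-lookup []      w k = refl
  ⧺-lookup (a ∷ x) w k = ⧺-lookup x w k

  ++-⧺ : ∀ x y (w : Word A) → (x ++ y) ⧺ w ≡ x ⧺ (y ⧺ w)
  ++-⧺ []      y w = refl
  ++-⧺ (a ∷ x) y w = cong (a ◂_) (++-⧺ x y w)

  -- One half of an Ehrenfeucht-Fraïssé round for until: `k` is answered by `k′`, and each position
  -- before `k′` is answered back by one before `k`. If `R` preserves the truth of both arguments,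
  -- an until true at `w` is true at `w′`.
  Matches : Rel (Word A) 0ℓ → Rel (Word A) 0ℓ
  Matches R w w′ = ∀ k → ∃[ k′ ]
    (R (w ↓ k) (w′ ↓ k′) × (∀ i′ → i′ < k′ → ∃[ i ] (i < k × R (w ↓ i) (w′ ↓ i′))))

  -- Indistinguishability by formulas with at most d nested temporal operators.
  data _∼[_]_ : Word A → ℕ → Word A → Set where
    base : ∀ {w w′} → w 0 ≡ w′ 0 → w ∼[ 0 ] w′
    step : ∀ {w w′ d} → w 0 ≡ w′ 0 → (w ↓ 1) ∼[ d ] (w′ ↓ 1) →
           Matches (λ u u′ → u ∼[ d ] u′) w w′ →
           Matches (λ u u′ → u ∼[ d ] u′) w′ w →
           w ∼[ suc d ] w′

  ∼-head : ∀ {d w w′} → w ∼[ d ] w′ → w 0 ≡ w′ 0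
  ∼-head (base h)       = h
  ∼-head (step h _ _ _) = h

  ∼-refl : ∀ {d} w → w ∼[ d ] w
  ∼-refl {zero}  w = base refl
  ∼-refl {suc d} w = step refl (∼-refl _) same same
    where
    same : Matches (λ u u′ → u ∼[ d ] u′) w w
    same k = k , ∼-refl _ , λ i i<k → i , i<k , ∼-refl _

  ∼-reflexive : ∀ {d w w′} → w ≡ w′ → w ∼[ d ] w′
  ∼-reflexive refl = ∼-refl _

  ∼-sym : ∀ {d w w′} → w ∼[ d ] w′ → w′ ∼[ d ] w
  ∼-sym (base h)       = base (sym h)
  ∼-sym (step h t f b) = step (sym h) (∼-sym t) b f

  ∼-trans : ∀ {d w w′ w″} → w ∼[ d ] w′ → w′ ∼[ d ] w″ → w ∼[ d ] w″
  ∼-trans (base h) (base h′) = base (trans h h′)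
  ∼-trans (step {w} {w′} {d} h t f b) (step {w′ = w″} h′ t′ f′ b′) =
    step (trans h h′) (∼-trans t t′) (compose w w′ w″ f f′) (compose w″ w′ w b′ b)
    where
    compose : ∀ (u v w : Word A) → Matches (λ u u′ → u ∼[ d ] u′) u v →
              Matches (λ u u′ → u ∼[ d ] u′) v w →
              Matches (λ u u′ → u ∼[ d ] u′) u w
    compose u v w f g k with f k
    ... | k′ , r , before with g k′
    ... | k″ , r′ , before′ = k″ , ∼-trans r r′ , λ i″ i″<k″ →
      let i′ , i′<k′ , s′ = before′ i″ i″<k″
          i , i<k , s     = before i′ i′<k′
      in i , i<k , ∼-trans s s′

  ∼-pred : ∀ {d w w′} → w ∼[ suc d ] w′ → w ∼[ d ] w′
  ∼-pred {zero}  (step h _ _ _) = base h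
  ∼-pred {suc d} {w} {w′} (step h t f b) = step h (∼-pred t) (weaken w w′ f) (weaken w′ w b)
    where
    weaken : ∀ (u v : Word A) → Matches (λ u u′ → u ∼[ suc d ] u′) u v →
             Matches (λ u u′ → u ∼[ d ] u′) u v
    weaken u v f k =
      let k′ , r , before = f k
      in k′ , ∼-pred r , λ i′ i′<k′ →
           let i , i<k , s = before i′ i′<k′ in i , i<k , ∼-pred s

  -- Positions of the old words are answered as before, shifted by one. The new position 0 is
  -- answered by itself, which needs the claim one level lower; hence the induction on `d`.
  ◂-cong : ∀ {d w w′} a → w ∼[ d ] w′ → (a ◂ w) ∼[ d ] (a ◂ w′)
  ◂-cong {zero}  a _ = base refl
  ◂-cong {suc d} {w} {w′} a e@(step h t f b) =
    step refl (∼-pred e) (shift w w′ f (◂-cong a (∼-pred e)))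
      (shift w′ w b (◂-cong a (∼-pred (∼-sym e))))
    where
    shift : ∀ (u v : Word A) → Matches (λ u u′ → u ∼[ d ] u′) u v →
            (a ◂ u) ∼[ d ] (a ◂ v) →
            Matches (λ u u′ → u ∼[ d ] u′) (a ◂ u) (a ◂ v)
    shift u v f r zero = 0 , r , λ _ ()
    shift u v f r (suc k) with f k
    ... | k′ , s , before = suc k′ , s , λ
      { zero     _            → 0 , z<s , r
      ; (suc i′) (s≤s i′<k′) →
          let i , i<k , s′ = before i′ i′<k′ in suc i , s≤s i<k , s′ }

  ⧺-cong : ∀ {d w w′} x → w ∼[ d ] w′ → (x ⧺ w) ∼[ d ] (x ⧺ w′)
  ⧺-cong []      e = e
  ⧺-cong (a ∷ x) e = ◂-cong a (⧺-cong x e)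

  ↓-⧺-cong : ∀ {d w w′} x k → k ≤ length x → w ∼[ d ] w′ →
             (x ⧺ w) ↓ k ∼[ d ] (x ⧺ w′) ↓ k
  ↓-⧺-cong x       zero    _         e = ⧺-cong x e
  ↓-⧺-cong (a ∷ x) (suc k) (s≤s k≤x) e = ↓-⧺-cong x k k≤x e

  -- A position inside the first copy of x is matched with itself, all others
  -- are moved by |x|, where the remaining words are equal.
  ⧺-deepen : ∀ {d} x {w : Word A} → w ∼[ d ] (x ⧺ w) → (x ⧺ w) ∼[ suc d ] (x ⧺ (x ⧺ w))
  ⧺-deepen [] _ = ∼-refl _
  ⧺-deepen {d} x@(a ∷ y) {w} e = step refl (⧺-cong y e) longer shorter
    where
    inside : ∀ k → k ≤ length x → (x ⧺ w) ↓ k ∼[ d ] (x ⧺ (x ⧺ w)) ↓ k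
    inside k k≤x = ↓-⧺-cong x k k≤x e

    beyond : ∀ k → (x ⧺ w) ↓ k ∼[ d ] (x ⧺ (x ⧺ w)) ↓ (length x + k)
    beyond k = ∼-reflexive (sym (↓-⧺ x (x ⧺ w) k))

    longer : Matches (λ u u′ → u ∼[ d ] u′) (x ⧺ w) (x ⧺ (x ⧺ w))
    longer k with ≤-total k (length x)
    ... | inj₁ k≤x = k , inside k k≤x , λ i i<k →
      i , i<k , inside i (≤-trans (<⇒≤ i<k) k≤x)
    ... | inj₂ x≤k = length x + k , beyond k , before
      where
      before : ∀ i′ → i′ < length x + k →
               ∃[ i ] (i < k × (x ⧺ w) ↓ i ∼[ d ] (x ⧺ (x ⧺ w)) ↓ i′)
      before i′ i′<x+k with i′ <? length x
      ... | yes i′<x = i′ , <-≤-trans i′<x x≤k , inside i′ (<⇒≤ i′<x)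
      ... | no  i′≮x with m≤n⇒∃[o]m+o≡n (≮⇒≥ i′≮x)
      ... | i , refl = i , +-cancelˡ-< (length x) i k i′<x+k , beyond i

    shorter : Matches (λ u u′ → u ∼[ d ] u′) (x ⧺ (x ⧺ w)) (x ⧺ w)
    shorter k with ≤-total k (length x)
    ... | inj₁ k≤x = k , ∼-sym (inside k k≤x) , λ i i<k →
      i , i<k , ∼-sym (inside i (≤-trans (<⇒≤ i<k) k≤x))
    ... | inj₂ x≤k with m≤n⇒∃[o]m+o≡n x≤k
    ... | m , refl = m , ∼-sym (beyond m) , λ i i<m →
      length x + i , +-monoʳ-< (length x) i<m , ∼-sym (beyond i)

  -- Powers of a finite word and aperiodicity.

  pow : List A → ℕ → Word A → Word A
  pow x zero    w = w
  pow x (suc n) w = x ⧺ pow x n w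

  pow-cong : ∀ {d w w′} x n → w ∼[ d ] w′ → pow x n w ∼[ d ] pow x n w′
  pow-cong x zero    e = e
  pow-cong x (suc n) e = ⧺-cong x (pow-cong x n e)

  pow-⧺ : ∀ x n (w : Word A) → pow x n (x ⧺ w) ≡ x ⧺ pow x n w
  pow-⧺ x zero    w = refl
  pow-⧺ x (suc n) w = cong (x ⧺_) (pow-⧺ x n w)

  concat-replicate-⧺ : ∀ x n (w : Word A) → concat (replicate n x) ⧺ w ≡ pow x n w
  concat-replicate-⧺ x zero    w = refl
  concat-replicate-⧺ x (suc n) w =
    trans (++-⧺ x _ w) (cong (x ⧺_) (concat-replicate-⧺ x n w))

  -- At depth 0 only the first letter counts, so one copy of `x` suffices; by `⧺-deepen`, each
  -- further copy pays for one more level.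
  aperiodic : ∀ d x w → pow x (suc d) w ∼[ d ] (x ⧺ pow x (suc d) w)
  aperiodic zero    []      w = ∼-refl _
  aperiodic zero    (a ∷ x) w = base refl
  aperiodic (suc d) x       w = ⧺-deepen x (aperiodic d x w)

  pow-absorbs : ∀ d x m w → pow x (suc d) (pow x m w) ∼[ d ] pow x (suc d) w
  pow-absorbs d x zero    w = ∼-refl _
  pow-absorbs d x (suc m) w =
    ∼-trans (∼-reflexive (pow-⧺ x (suc d) (pow x m w)))
      (∼-trans (∼-sym (aperiodic d x (pow x m w))) (pow-absorbs d x m w))

-- The absorbing block Z

-- A variant of the Zimin words, which satisfy `Z (i + 1) = Z i · i · Z i`: the period
-- `block d i ∷ʳ i` is repeated up to the threshold `suc d` of `aperiodic`. The final `block d i`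
-- becomes a full period as soon as `i` follows.
block : ℕ → ℕ → List ℕ
block d zero    = []
block d (suc i) = concat (replicate (suc d) (block d i ∷ʳ i)) ++ block d i

block-suc-⧺ : ∀ d i w →
  block d (suc i) ⧺ w ≡ pow (block d i ∷ʳ i) (suc d) (block d i ⧺ w)
block-suc-⧺ d i w =
  trans (++-⧺ (concat (replicate (suc d) (block d i ∷ʳ i))) (block d i) w)
    (concat-replicate-⧺ (block d i ∷ʳ i) (suc d) (block d i ⧺ w))

block-letters : ∀ d i → All (_< i) (block d i)
block-letters d zero    = []
block-letters d (suc i) = All.++⁺ (All.concat⁺ (All.replicate⁺ (suc d) period)) weakened
  where
  weakened : All (_< suc i) (block d i)
  weakened = All.map m<n⇒m<1+n (block-letters d i)

  period : All (_< suc i) (block d i ∷ʳ i)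
  period = All.∷ʳ⁺ weakened (n<1+n i)

-- Induction on `i`. Unfolding both blocks gives `suc d` periods `x`, then `block d i`, `j`, and
-- again `suc d` periods. `middle` turns everything after the first power into copies of `x` before
-- the same tail, and `pow-absorbs` removes these.
block-absorbs : ∀ d i j → j < i → ∀ w →
  (block d i ⧺ (j ◂ (block d i ⧺ w))) ∼[ d ] (block d i ⧺ w)
block-absorbs d (suc i) j (s≤s j≤i) w
  rewrite block-suc-⧺ d i w
        | block-suc-⧺ d i (j ◂ pow (block d i ∷ʳ i) (suc d) (block d i ⧺ w))
  = let m , e = middle (m≤n⇒m<n∨m≡n j≤i)
    in ∼-trans (pow-cong x (suc d) e) (pow-absorbs d x m (block d i ⧺ w))
  where
  x : List ℕ
  x = block d i ∷ʳ i

  powers : ℕ → Word ℕ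
  powers m = pow x m (block d i ⧺ w)

  middle : j < i ⊎ j ≡ i → ∃[ m ] ((block d i ⧺ (j ◂ powers (suc d))) ∼[ d ] powers m)
  -- Here `block d i` and the letter `i` form one more period in front of the `suc d` others.
  middle (inj₂ refl) = suc (suc d) ,
    ∼-reflexive (sym (++-⧺ (block d i) (i ∷ []) (powers (suc d))))
  -- The powers behind `j` begin with `block d i`, so the induction hypothesis deletes `j` together
  -- with one copy of `block d i`.
  middle (inj₁ j<i)  = suc d ,
    ∼-trans (⧺-cong (block d i) (◂-cong j (∼-reflexive unfold)))
      (∼-trans (block-absorbs d i j j<i (i ◂ powers d)) (∼-reflexive (sym unfold)))
    where
    unfold : powers (suc d) ≡ block d i ⧺ (i ◂ powers d)
    unfold = ++-⧺ (block d i) (i ∷ []) (powers d)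

-- Otherwise mapping each number below `N` to its position in `L` would contradict the pigeonhole
-- principle.
fresh : ∀ N (L : List ℕ) → length L < N → ∃[ j ] (j < N × j ∉ L)
fresh N L L<N =
  let i , i∉L = Fin.¬∀⟶∃¬ N (λ i → toℕ i ∈ L) (λ i → DecMembership._∈?_ _≟_ (toℕ i) L) notAll
  in toℕ i , Fin.toℕ<n i , i∉L
  where
  notAll : ¬ (∀ (i : Fin N) → toℕ i ∈ L)
  notAll all =
    let i , j , i<j , eq = Fin.pigeonhole L<N (λ i → index (all i))
    in <⇒≢ i<j (Membership.index-injective (setoid ℕ) (all i) (all j) eq)

-- Teams of rows

module _ {AP : Set} where

  -- Letter l stands for the column that lacks every proposition in row l and
  -- has every proposition in all other rows.
  row : ℕ → Word ℕ → Trace AP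
  row i w k q = not (does (w k ≟ i))

  row-≢ : ∀ {i w k} q → w k ≢ i → row i w k q ≡ true
  row-≢ {i} {w} {k} q ne rewrite dec-false (w k ≟ i) ne = refl

  row-≡ : ∀ {i w k} q → w k ≡ i → ¬ (row i w k q ≡ true)
  row-≡ {i} {w} {k} q eq r rewrite dec-true (w k ≟ i) eq with r
  ... | ()

  rows : ℕ → Word ℕ → Team AP
  rows N w .member t = ∃[ i ] (i < N × row i w ≈ t)
  rows N w .resp t≈t′ (i , i<N , e) = i , i<N , λ k q → trans (e k q) (t≈t′ k q)

  row-◂-cong : ∀ {i u v} a → row i u ≈ row i v → row i (a ◂ u) ≈ row i (a ◂ v)
  row-◂-cong a e zero    q = refl
  row-◂-cong a e (suc k) q = e k q

  row-⧺-cong : ∀ {i u v} x → row i u ≈ row i v → row i (x ⧺ u) ≈ row i (x ⧺ v)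
  row-⧺-cong []      e = e
  row-⧺-cong (a ∷ x) e = row-◂-cong a (row-⧺-cong x e)

  row-swap : ∀ {i} a b v → a ≢ i → b ≢ i → row i (a ◂ v) ≈ row i (b ◂ v)
  row-swap {i} a b v a≢i b≢i zero    q =
    trans (row-≢ {i} {a ◂ v} {0} q a≢i) (sym (row-≢ {i} {b ◂ v} {0} q b≢i))
  row-swap a b v _ _ (suc k) q = refl

-- Transfer of HyperLTL satisfaction

module _ {AP 𝒱 : Set} where

  -- Both traces have the same row index, so equal current letters give equal atoms. `P` confines
  -- the index to the rows chosen so far.
  data Reads (P : ℕ → Set) (w w′ : Word ℕ) (t t′ : Trace AP) : Set where
    reads : ∀ i → P i → t ≈ row i w → t′ ≈ row i w′ → Reads P w w′ t t′

  Linked : (ℕ → Set) → Word ℕ → Word ℕ → Assignment AP 𝒱 → Assignment AP 𝒱 → Set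
  Linked P w w′ Π Π′ = ∀ π → Pointwise (Reads P w w′) (Π π) (Π′ π)

  Pointwise-map : ∀ {R S : Rel (Trace AP) 0ℓ} {f g : Trace AP → Trace AP} →
    (∀ {t t′} → R t t′ → S (f t) (g t′)) →
    ∀ {m m′} → Pointwise R m m′ → Pointwise S (Maybe.map f m) (Maybe.map g m′)
  Pointwise-map h (just r) = just (h r)
  Pointwise-map h nothing  = nothing

  Pointwise-if : ∀ {R : Rel (Trace AP) 0ℓ} b {m₁ m₁′ m₂ m₂′} →
    Pointwise R m₁ m₁′ → Pointwise R m₂ m₂′ →
    Pointwise R (if b then m₁ else m₂) (if b then m₁′ else m₂′)
  Pointwise-if true  r _ = r
  Pointwise-if false _ r = r

  Linked-↓ : ∀ {P w w′ Π Π′} k k′ → Linked P w w′ Π Π′ →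
    Linked P (w ↓ k) (w′ ↓ k′) (Π ⟪ k ,∞⟩) (Π′ ⟪ k′ ,∞⟩)
  Linked-↓ k k′ l π = Pointwise-map
    (λ { (reads i pi e e′) → reads i pi (λ n → e (k + n)) (λ n → e′ (k′ + n)) }) (l π)

  Linked-sym : ∀ {P w w′ Π Π′} → Linked P w w′ Π Π′ → Linked P w′ w Π′ Π
  Linked-sym {P} {w} {w′} {Π} {Π′} l π = flip (l π)
    where
    flip : ∀ {m m′} → Pointwise (Reads P w w′) m m′ → Pointwise (Reads P w′ w) m′ m
    flip (just (reads i pi e e′)) = just (reads i pi e′ e)
    flip nothing                  = nothing

  depthᵇ : Body AP 𝒱 → ℕ
  depthᵇ (q at π)   = 0
  depthᵇ (¬ʰ ψ)     = depthᵇ ψ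
  depthᵇ (ψ₁ ∨ʰ ψ₂) = depthᵇ ψ₁ ⊔ depthᵇ ψ₂
  depthᵇ (Xʰ ψ)     = suc (depthᵇ ψ)
  depthᵇ (ψ₁ Uʰ ψ₂) = suc (depthᵇ ψ₁ ⊔ depthᵇ ψ₂)

  -- Negation exchanges the two words, which `∼-sym` and `Linked-sym` permit; until follows the
  -- answers given by `Matches`. Depth is only bounded by `d`, so that both arguments of a binary
  -- operator can use the same `d`.
  ∼⇒⊨ᵇ : ∀ {P d w w′} ψ {Π Π′} → depthᵇ ψ ≤ d → w ∼[ d ] w′ →
    Linked P w w′ Π Π′ → Π ⊨ᵇ ψ → Π′ ⊨ᵇ ψ
  ∼⇒⊨ᵇ {P} {d} {w} {w′} (q at π) _ e l = atom (l π)
    where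
    atom : ∀ {m m′} → Pointwise (Reads P w w′) m m′ →
           Any (λ t → t 0 q ≡ true) m → Any (λ t → t 0 q ≡ true) m′
    atom (just (reads i _ r r′)) (just h) = just (trans (r′ 0 q)
      (trans (cong (λ a → not (does (a ≟ i))) (sym (∼-head e))) (trans (sym (r 0 q)) h)))
  ∼⇒⊨ᵇ (¬ʰ ψ) ψ≤d e l s s′ = s (∼⇒⊨ᵇ ψ ψ≤d (∼-sym e) (Linked-sym l) s′)
  ∼⇒⊨ᵇ (ψ₁ ∨ʰ ψ₂) ψ≤d e l = Sum.map
    (∼⇒⊨ᵇ ψ₁ (m⊔n≤o⇒m≤o (depthᵇ ψ₁) (depthᵇ ψ₂) ψ≤d) e l)
    (∼⇒⊨ᵇ ψ₂ (m⊔n≤o⇒n≤o (depthᵇ ψ₁) (depthᵇ ψ₂) ψ≤d) e l)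
  ∼⇒⊨ᵇ (Xʰ ψ) (s≤s ψ≤d) (step _ e _ _) l = ∼⇒⊨ᵇ ψ ψ≤d e (Linked-↓ 1 1 l)
  ∼⇒⊨ᵇ (ψ₁ Uʰ ψ₂) (s≤s ψ≤d) (step _ _ f _) l (k , s₂ , s₁) =
    let k′ , e , before = f k
    in k′
     , ∼⇒⊨ᵇ ψ₂ (m⊔n≤o⇒n≤o (depthᵇ ψ₁) (depthᵇ ψ₂) ψ≤d) e (Linked-↓ k k′ l) s₂
     , λ i′ i′<k′ →
         let i , i<k , e′ = before i′ i′<k′
         in ∼⇒⊨ᵇ ψ₁ (m⊔n≤o⇒m≤o (depthᵇ ψ₁) (depthᵇ ψ₂) ψ≤d) e′ (Linked-↓ i i′ l) (s₁ i i<k)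

  depth : HyperLTL AP 𝒱 → ℕ
  depth (∃ʰ _ φ) = depth φ
  depth (∀ʰ _ φ) = depth φ
  depth (body ψ) = depthᵇ ψ

  quantifiers : HyperLTL AP 𝒱 → ℕ
  quantifiers (∃ʰ _ φ) = suc (quantifiers φ)
  quantifiers (∀ʰ _ φ) = suc (quantifiers φ)
  quantifiers (body ψ) = 0

  module _ (countable : 𝒱 ↣ ℕ) where

    Linked-update : ∀ {L w w′ Π Π′} π i {t t′} → Linked (_∈ L) w w′ Π Π′ →
      row i w ≈ t → row i w′ ≈ t′ →
      Linked (_∈ i ∷ L) w w′ (update countable Π π t) (update countable Π′ π t′)
    Linked-update {L} {w} {w′} {Π} {Π′} π i l e e′ π′ =
      Pointwise-if (does (_≟ᵛ_ {AP} countable π′ π))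
        (just (reads i (here refl) (λ k q → sym (e k q)) (λ k q → sym (e′ k q))))
        (weaken (l π′))
      where
      weaken : ∀ {m m′} → Pointwise (Reads (_∈ L) w w′) m m′ →
               Pointwise (Reads (_∈ i ∷ L) w w′) m m′
      weaken (just (reads i i∈L r r′)) = just (reads i (there i∈L) r r′)
      weaken nothing              = nothing

    -- Every quantifier is answered by the row of the same index in the other team. It moves one
    -- unit from `quantifiers φ` to `length L`, so at most `n` rows are in use when the body is
    -- reached.
    Sat-transfer : ∀ {N n d w w′} →
      (∀ {L Π Π′} ψ → depthᵇ ψ ≤ d → length L ≤ n → All (_< N) L →
        Linked (_∈ L) w w′ Π Π′ → Π ⊨ᵇ ψ → Π′ ⊨ᵇ ψ) →
      ∀ φ {L Π Π′} → depth φ ≤ d → length L + quantifiers φ ≤ n → All (_< N) L →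
      Linked (_∈ L) w w′ Π Π′ →
      Sat countable (rows N w) Π φ → Sat countable (rows N w′) Π′ φ
    Sat-transfer {n = n} {w′ = w′} transfer (∃ʰ π φ) {L} φ≤d L≤n L<N l (t , (i , i<N , e) , s) =
      row i w′ , (i , i<N , λ _ _ → refl) ,
      Sat-transfer transfer φ φ≤d (subst (_≤ n) (+-suc (length L) (quantifiers φ)) L≤n)
        (i<N ∷ L<N) (Linked-update π i l e (λ _ _ → refl)) s
    Sat-transfer {n = n} {w = w} transfer (∀ʰ π φ) {L} φ≤d L≤n L<N l s t′ (i , i<N , e′) =
      Sat-transfer transfer φ φ≤d (subst (_≤ n) (+-suc (length L) (quantifiers φ)) L≤n)
        (i<N ∷ L<N) (Linked-update π i l (λ _ _ → refl) e′)
        (s (row i w) (i , i<N , λ _ _ → refl))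
    Sat-transfer {n = n} transfer (body ψ) {L} φ≤d L≤n L<N l =
      transfer ψ φ≤d (subst (_≤ n) (+-identityʳ (length L)) L≤n) L<N l

-- The two teams

module _ (d n : ℕ) where

  Z : List ℕ
  Z = block d (suc n)

  Z₀ : Word ℕ
  Z₀ = Z ⧺ const 0

  ZfullZ₀ : Word ℕ
  ZfullZ₀ = Z ⧺ (suc n ◂ Z₀)

  Z₀-letters : ∀ k → Z₀ k < suc n
  Z₀-letters = go Z (block-letters d (suc n))
    where
    go : ∀ x → All (_< suc n) x → ∀ k → (x ⧺ const 0) k < suc n
    go []      _           k       = z<s
    go (a ∷ x) (a<N ∷ _)   zero    = a<N
    go (a ∷ x) (_   ∷ x<N) (suc k) = go x x<N k

  ZfullZ₀-full : ZfullZ₀ (length Z + 0) ≡ suc n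
  ZfullZ₀-full = ⧺-lookup Z (suc n ◂ Z₀) 0

  module _ {AP 𝒱 : Set} where

    few-rows-⊨ᵇ : ∀ {L} {Π Π′ : Assignment AP 𝒱} ψ → depthᵇ ψ ≤ d → length L ≤ n →
      All (_< suc n) L → Linked (_∈ L) ZfullZ₀ Z₀ Π Π′ → Π ⊨ᵇ ψ → Π′ ⊨ᵇ ψ
    few-rows-⊨ᵇ {L} {Π} {Π′} ψ ψ≤d L≤n L<N l with fresh (suc n) L (s≤s L≤n)
    ... | j , j<N , j∉L =
      ∼⇒⊨ᵇ ψ ψ≤d (block-absorbs d (suc n) j j<N (const 0)) (λ π → relink (l π))
      where
      unfull : ∀ i → i ∈ L → row {AP} i ZfullZ₀ ≈ row i (Z ⧺ (j ◂ Z₀))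
      -- No row in `L` sees the exchanged letters: `suc n` exceeds every index in `L`, and `j` was
      -- chosen outside `L`.
      unfull i i∈L = row-⧺-cong Z (row-swap (suc n) j Z₀
        (λ { refl → <-irrefl refl (All.lookup L<N i∈L) }) (λ { refl → j∉L i∈L }))

      relink : ∀ {m m′} → Pointwise (Reads {AP} {𝒱} (_∈ L) ZfullZ₀ Z₀) m m′ →
               Pointwise (Reads {AP} {𝒱} (_∈ L) (Z ⧺ (j ◂ Z₀)) Z₀) m m′
      relink (just (reads i i∈L e e′)) =
        just (reads i i∈L (λ k q → trans (e k q) (unfull i i∈L k q)) e′)
      relink nothing = nothing

  module _ {AP : Set} (q p : AP) where

    Z₀-⊭F : ¬ (rows (suc n) Z₀ ⊨ᵗ Fᵗ q (posᵗ p))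
    -- The letter at the proposed time names a row that lacks `p` there. It is read at `k + 0`, the
    -- form to which position 0 of a suffix unfolds.
    Z₀-⊭F (k , lift h , _) = row-≡ {AP} {Z₀ (k + 0)} {Z₀} {k + 0} p refl
      (h (row (Z₀ (k + 0)) Z₀ [ k ,∞⟩)
        (_ , (_ , Z₀-letters (k + 0) , λ _ _ → refl) , λ _ _ → refl))

    ZfullZ₀-⊨F : rows (suc n) ZfullZ₀ ⊨ᵗ Fᵗ q (posᵗ p)
    -- At this time the letter is `suc n`, which differs from every row index.
    ZfullZ₀-⊨F = length Z , lift full , λ k′ _ → ⊨⊤ᵗ q (rows (suc n) ZfullZ₀ ⟦ k′ ,∞⟩)
      where
      full : ∀ t → member (rows (suc n) ZfullZ₀ ⟦ length Z ,∞⟩) t → t 0 p ≡ true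
      full t (t₀ , (i , i<N , e) , e′) = trans (sym (e′ 0 p)) (trans (sym (e (length Z + 0) p))
        (row-≢ {AP} {i} {ZfullZ₀} {length Z + 0} p
          (λ eq → <⇒≢ i<N (trans (sym eq) ZfullZ₀-full))))

-- Inexpressibility in both directions.

theorem6p1 : (AP 𝒱 : Set) → AP ↔ ℕ → (countable : 𝒱 ↣ ℕ) → (p : AP) →
    ((π : 𝒱) → ¬ (∃[ χ ] Equivalent countable (∃ʰ π (body (p at π))) χ))
    × ((q : AP) → ¬ (∃[ φ ] (IsSentence φ × Equivalent countable φ (Fᵗ q (posᵗ p)))))
theorem6p1 AP 𝒱 _ countable p = existential , synchronous
  where
  existential : (π : 𝒱) → ¬ (∃[ χ ] Equivalent countable (∃ʰ π (body (p at π))) χ)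
  existential π (χ , equiv)
    with Equivalence.from (equiv ∅) (empty-⊨ᵗ χ ∅ λ _ ())
  ... | _ , () , _

  synchronous : (q : AP) →
    ¬ (∃[ φ ] (IsSentence φ × Equivalent countable φ (Fᵗ q (posᵗ p))))
  synchronous q (φ , _ , equiv) = Z₀-⊭F d n q p
    (Equivalence.to (equiv (rows (suc n) (Z₀ d n)))
      -- Before any quantifier no row is chosen, so both bounds hold with equality and the empty
      -- assignments are linked.
      (Sat-transfer countable (few-rows-⊨ᵇ d n) φ {[]} ≤-refl ≤-refl [] (λ _ → nothing)
        (Equivalence.from (equiv (rows (suc n) (ZfullZ₀ d n))) (ZfullZ₀-⊨F d n q p))))
    where
    d n : ℕ
    d = depth φ
    n = quantifiers φ
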